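{- Let $R$ be a Noetherian ring and let $\mathcal{A}=\{I\in A(R)^* \mid I\subseteq \mathrm{Nil}(R)\}$. Then the following statements hold: (1) If $|\mathrm{Min}(R)|\geq 2$, then $\omega(\mathcal{EG}(R))=\chi(\mathcal{EG}(R))=|\mathrm{Min}(R)|+|\mathcal{A}|$. (2) If $|\mathrm{Min}(R)|=1$, then $|\mathcal{A}|\leq \omega(\mathcal{EG}(R))=\chi(\mathcal{EG}(R))\leq |\mathcal{A}|+1$.
   Context: All rings are commutative with identity. $A(R)$ is the set of ideals of $R$ with non-zero annihilator, and $A(R)^*=A(R)\setminus\{(0)\}$. $\mathrm{Min}(R)$ is the set of minimal prime ideals and $\mathrm{Nil}(R)$ the nilradical of $R$. A non-zero ideal $I$ of $R$ is essential, written $I\leq_e R$, if it has non-zero intersection with every non-zero ideal of $R$. The essential annihilating-ideal graph $\mathcal{EG}(R)$ is the simple graph with vertex set $A(R)^*$ in which two distinct vertices $I,J$ are adjacent if and only if $\mathrm{Ann}(IJ)\leq_e R$. $\omega(G)$ denotes the clique number (the number of vertices in a largest complete subgraph) and $\chi(G)$ the vertex chromatic number of $G$. Cardinalities and these invariants take values in $\mathbb{N}\cup\{\infty\}$, where $\infty$ is written for any infinite value. -}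

module Defs where

open import Algebra.Bundles using (CommutativeRing)
import Algebra.Properties.Semiring.Exp as Exp
open import Axiom.ExcludedMiddle using (ExcludedMiddle)
open import Data.Fin.Base using (Fin)
open import Data.Nat.Base as ℕ using (ℕ)
open import Data.Product.Base using (Σ; ∃; ∃-syntax; _×_; _,_; proj₁; proj₂)
open import Data.Sum.Base using (_⊎_)
open import Data.Vec.Functional using (Vector)
open import Function.Bundles using (Func; Inverse)
open import Level using (Level; Setω; Lift; lift; suc; _⊔_)
open import Relation.Binary.Bundles using (Setoid)
open import Relation.Binary.Core using (Rel)
open import Relation.Binary.Definitions using (Symmetric; Irreflexive; _Respects_; _Respects₂_)
import Relation.Binary.Construct.Add.Supremum.NonStrict as AddSupremum
import Relation.Binary.Construct.On as On
import Relation.Binary.PropositionalEquality as ≡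
open ≡ using (_≢_)
open import Relation.Nullary using (¬_; yes; no)
open import Relation.Nullary.Construct.Add.Supremum using (_⁺; ⊤⁺; [_])
open import Relation.Unary using (Pred; _⊆_; _≐_; _∩_)
open import Relation.Unary.Properties using (≐-refl; ≐-sym; ≐-trans)

-- The ambient logic of ordinary mathematics.  `ExcludedMiddle` decides
-- arbitrary types, not only propositions, so since existence is expressed
-- by Σ-types it also supplies choice.

Classical : Setω
Classical = ∀ a → ExcludedMiddle a

------------------------------------------------------------------------
-- ℕ ∪ {∞}

ℕ∞ : Set
ℕ∞ = ℕ ⁺

pattern ∞ = ⊤⁺

infixl 6 _+∞_
_+∞_ : ℕ∞ → ℕ∞ → ℕ∞
[ m ] +∞ [ n ] = [ m ℕ.+ n ]
[ m ] +∞ ∞     = ∞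
∞     +∞ n     = ∞

open AddSupremum ℕ._≤_ public using () renaming (_≤⁺_ to infix 4 _≤∞_)

-- The number n with P n, or ∞ if there is none.  Each of the predicates P
-- used below holds of at most one number.

the : ∀ {p} → Classical → Pred ℕ p → ℕ∞
the {p} em P with em p {∃ P}
... | yes (n , _) = [ n ]
... | no _        = ∞

card : ∀ {a r} → Classical → Setoid a r → ℕ∞
card em S = the em λ n → Inverse (≡.setoid (Fin n)) S

------------------------------------------------------------------------
-- Graphs

record SimpleGraph (v r e : Level) : Set (suc (v ⊔ r ⊔ e)) where
  field
    vertices : Setoid v r
  open Setoid vertices public using () renaming (Carrier to Vertex; _≈_ to _≈ⱽ_)
  infix 4 _~_
  field
    _~_    : Rel Vertex e
    resp   : _~_ Respects₂ _≈ⱽ_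
    sym    : Symmetric _~_
    irrefl : Irreflexive _≈ⱽ_ _~_

module _ {v r e : Level} (G : SimpleGraph v r e) where
  open SimpleGraph G

  -- Adjacent vertices are distinct, so such a family is injective and
  -- lists the vertices of a complete subgraph with n vertices.

  HasClique : ℕ → Set (v ⊔ e)
  HasClique n = Σ (Vector Vertex n) λ f → ∀ i j → i ≢ j → f i ~ f j

  Colourable : ℕ → Set (v ⊔ r ⊔ e)
  Colourable n = Σ (Func vertices (≡.setoid (Fin n))) λ f →
    ∀ {x y} → x ~ y → Func.to f x ≢ Func.to f y

-- If there are cliques of every finite size then no n qualifies, giving ∞.

cliqueNumber : ∀ {v r e} → Classical → SimpleGraph v r e → ℕ∞
cliqueNumber em G = the em λ n →
  HasClique G n × (∀ m → HasClique G m → m ℕ.≤ n)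

chromaticNumber : ∀ {v r e} → Classical → SimpleGraph v r e → ℕ∞
chromaticNumber em G = the em λ n →
  Colourable G n × (∀ m → Colourable G m → n ℕ.≤ m)

------------------------------------------------------------------------
-- Ideals

module _ {c ℓ : Level} (R : CommutativeRing c ℓ) where
  open CommutativeRing R
  open Exp semiring using (_^_)

  -- Membership lives at level c ⊔ ℓ.  Given `Classical`, every predicate on
  -- the ring is equivalent to one at this level, so quantifying over
  -- `Ideal` is quantifying over all ideals.

  record Ideal : Set (suc (c ⊔ ℓ)) where
    field
      Mem      : Pred Carrier (c ⊔ ℓ)
      respects : Mem Respects _≈_
      0∈       : Mem 0#
      +-closed : ∀ {x y} → Mem x → Mem y → Mem (x + y)
      *-closed : ∀ r {x} → Mem x → Mem (r * x)
  open Ideal using (Mem)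

  infix 4 _≈ᴵ_
  _≈ᴵ_ : Rel Ideal (c ⊔ ℓ)
  I ≈ᴵ J = Mem I ≐ Mem J

  ideals : Setoid (suc (c ⊔ ℓ)) (c ⊔ ℓ)
  ideals = record
    { Carrier       = Ideal
    ; _≈_           = _≈ᴵ_
    ; isEquivalence = record { refl = ≐-refl ; sym = ≐-sym ; trans = ≐-trans }
    }

  idealsWith : ∀ {p} → Pred Ideal p → Setoid (suc (c ⊔ ℓ) ⊔ p) (c ⊔ ℓ)
  idealsWith P = On.setoid ideals (proj₁ {B = P})

  data Span (S : Pred Carrier (c ⊔ ℓ)) : Pred Carrier (c ⊔ ℓ) where
    gen   : ∀ {x} → S x → Span S x
    resp  : ∀ {x y} → x ≈ y → Span S x → Span S y
    zero′ : Span S 0#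
    add   : ∀ {x y} → Span S x → Span S y → Span S (x + y)
    mul   : ∀ r {x} → Span S x → Span S (r * x)

  ⟨_⟩ : Pred Carrier (c ⊔ ℓ) → Ideal
  ⟨ S ⟩ = record
    { Mem = Span S ; respects = resp ; 0∈ = zero′ ; +-closed = add ; *-closed = mul }

  zeroIdeal : Ideal
  zeroIdeal = record
    { Mem      = λ x → Lift c (x ≈ 0#)
    ; respects = λ x≈y (lift x≈0) → lift (trans (sym x≈y) x≈0)
    ; 0∈       = lift refl
    ; +-closed = λ (lift p) (lift q) → lift (trans (+-cong p q) (+-identityˡ 0#))
    ; *-closed = λ r (lift p) → lift (trans (*-congˡ p) (zeroʳ r))
    }

  NonZero : Pred Ideal (c ⊔ ℓ)
  NonZero I = ¬ (I ≈ᴵ zeroIdeal)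

  infixl 7 _·_
  _·_ : Ideal → Ideal → Ideal
  I · J = ⟨ (λ x → ∃[ a ] ∃[ b ] Mem I a × Mem J b × x ≈ a * b) ⟩

  infixr 7 _∩ᴵ_
  _∩ᴵ_ : Ideal → Ideal → Ideal
  I ∩ᴵ J = record
    { Mem      = Mem I ∩ Mem J
    ; respects = λ x≈y (p , q) → Ideal.respects I x≈y p , Ideal.respects J x≈y q
    ; 0∈       = Ideal.0∈ I , Ideal.0∈ J
    ; +-closed = λ (p , q) (p′ , q′) → Ideal.+-closed I p p′ , Ideal.+-closed J q q′
    ; *-closed = λ r (p , q) → Ideal.*-closed I r p , Ideal.*-closed J r q
    }

  Ann : Ideal → Ideal
  Ann I = record
    { Mem      = λ x → ∀ {y} → Mem I y → x * y ≈ 0#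
    ; respects = λ x≈x′ p y∈I → trans (*-congʳ (sym x≈x′)) (p y∈I)
    ; 0∈       = λ {y} _ → zeroˡ y
    ; +-closed = λ {x} {x′} p q {y} y∈I → trans (distribʳ y x x′)
                   (trans (+-cong (p y∈I) (q y∈I)) (+-identityˡ 0#))
    ; *-closed = λ r {x} p {y} y∈I → trans (*-assoc r x y)
                   (trans (*-congˡ (p y∈I)) (zeroʳ r))
    }

  Essential : Pred Ideal (suc (c ⊔ ℓ))
  Essential I = NonZero I × (∀ K → NonZero K → NonZero (I ∩ᴵ K))

  FinitelyGenerated : Pred Ideal (c ⊔ ℓ)
  FinitelyGenerated I = ∃[ n ] Σ (Vector Carrier n) λ g →
    I ≈ᴵ ⟨ (λ x → Lift c (∃[ i ] x ≈ g i)) ⟩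

  Noetherian : Set (suc (c ⊔ ℓ))
  Noetherian = ∀ I → FinitelyGenerated I

  IsPrime : Pred Ideal (c ⊔ ℓ)
  IsPrime P = ¬ Mem P 1# × (∀ {x y} → Mem P (x * y) → Mem P x ⊎ Mem P y)

  IsMinimalPrime : Pred Ideal (suc (c ⊔ ℓ))
  IsMinimalPrime P =
    IsPrime P × (∀ Q → IsPrime Q → Mem Q ⊆ Mem P → Q ≈ᴵ P)

  Min : Setoid (suc (c ⊔ ℓ)) (c ⊔ ℓ)
  Min = idealsWith IsMinimalPrime

  Nil : Pred Carrier ℓ
  Nil x = ∃[ n ] x ^ n ≈ 0#

  IsVertex : Pred Ideal (c ⊔ ℓ)
  IsVertex I = NonZero (Ann I) × NonZero I

  𝒜 : Setoid (suc (c ⊔ ℓ)) (c ⊔ ℓ)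
  𝒜 = idealsWith λ I → IsVertex I × Mem I ⊆ Nil

  NonZero-mono : ∀ {I J} → Mem I ⊆ Mem J → NonZero I → NonZero J
  NonZero-mono {I} I⊆J I≢0 (J⊆0 , _) =
    I≢0 ((λ x∈I → J⊆0 (I⊆J x∈I)) ,
         (λ (lift x≈0) → Ideal.respects I (sym x≈0) (Ideal.0∈ I)))

  Essential-mono : ∀ {I J} → Mem I ⊆ Mem J → Essential I → Essential J
  Essential-mono {I} {J} I⊆J (I≢0 , ess) =
    NonZero-mono {I} {J} I⊆J I≢0 ,
    λ K K≢0 → NonZero-mono {I ∩ᴵ K} {J ∩ᴵ K} (λ (p , q) → I⊆J p , q) (ess K K≢0)

  Ann-anti : ∀ {I J} → Mem I ⊆ Mem J → Mem (Ann J) ⊆ Mem (Ann I)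
  Ann-anti I⊆J p y∈I = p (I⊆J y∈I)

  Span-mono : ∀ {S T} → S ⊆ T → Span S ⊆ Span T
  Span-mono S⊆T (gen s)    = gen (S⊆T s)
  Span-mono S⊆T (resp e p) = resp e (Span-mono S⊆T p)
  Span-mono S⊆T zero′      = zero′
  Span-mono S⊆T (add p q)  = add (Span-mono S⊆T p) (Span-mono S⊆T q)
  Span-mono S⊆T (mul r p)  = mul r (Span-mono S⊆T p)

  ·-mono : ∀ {I I′ J J′} → Mem I ⊆ Mem I′ → Mem J ⊆ Mem J′ →
           Mem (I · J) ⊆ Mem (I′ · J′)
  ·-mono f g = Span-mono λ (a , b , p , q , e) → a , b , f p , g q , e

  ·-comm : ∀ {I J} → Mem (I · J) ⊆ Mem (J · I)
  ·-comm = Span-mono λ (a , b , p , q , e) → b , a , q , p , trans e (*-comm a b)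

  EG : SimpleGraph (suc (c ⊔ ℓ)) (c ⊔ ℓ) (suc (c ⊔ ℓ))
  EG = record
    { vertices = idealsWith IsVertex
    ; _~_      = λ (I , _) (J , _) → ¬ (I ≈ᴵ J) × Essential (Ann (I · J))
    ; resp     =
        (λ {(I , _)} {(J , _)} {(J′ , _)} J≈J′ (I≉J , ess) →
          (λ I≈J′ → I≉J (≐-trans I≈J′ (≐-sym J≈J′))) ,
          Essential-mono {Ann (I · J)} {Ann (I · J′)}
            (Ann-anti {I · J′} {I · J} (·-mono {I} {I} {J′} {J} (λ p → p) (proj₂ J≈J′))) ess) ,
        (λ {(J , _)} {(I , _)} {(I′ , _)} I≈I′ (I≉J , ess) →
          (λ I′≈J → I≉J (≐-trans I≈I′ I′≈J)) ,
          Essential-mono {Ann (I · J)} {Ann (I′ · J)}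
            (Ann-anti {I′ · J} {I · J} (·-mono {I′} {I} {J} {J} (proj₂ I≈I′) (λ p → p))) ess)
    ; sym      = λ {(I , _)} {(J , _)} (I≉J , ess) →
        (λ J≈I → I≉J (≐-sym J≈I)) ,
        Essential-mono {Ann (I · J)} {Ann (J · I)}
          (Ann-anti {J · I} {I · J} (·-comm {J} {I})) ess
    ; irrefl   = λ I≈J (I≉J , _) → I≉J I≈J
    }

{-# OPTIONS --safe #-}

-- In a Noetherian ring I and J are adjacent exactly when they are distinct and
-- IJ ⊆ Nil R.  If b ∈ IJ is not nilpotent, then for large n the ideal (bⁿ) is
-- non-zero and meets Ann(b) trivially, so Ann(IJ) is not essential; conversely
-- every non-zero ideal contains a non-zero element killed by all nilpotents.
--
-- Let P₁, …, Pₘ be the minimal primes, so that ⋂ Pᵢ = Nil R.  The members of 𝒜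
-- are adjacent to every other vertex, and for m ≥ 2 the ideals ⋂_{j≠i} Pⱼ
-- extend 𝒜 to a clique with m + |𝒜| vertices.  Conversely, giving each member
-- of 𝒜 its own colour and any other vertex I an index i with I ⊈ Pᵢ is a proper
-- colouring.  For m = 1 the clique 𝒜 is extended by a vertex outside 𝒜 if there
-- is one.  If 𝒜 is infinite it already contains arbitrarily large cliques.
module Submission where

open import Defs
open import Algebra.Bundles using (CommutativeRing)
open import Data.Product.Base using (_×_)
open import Relation.Binary.PropositionalEquality using (_≡_)
open import Relation.Nullary.Construct.Add.Supremum using ([_])

import Algebra.Properties.Semiring.Exp as Exp
open import Data.Empty using (⊥-elim)
open import Data.Fin.Base as Fin using (Fin; splitAt; join; punchIn; punchOut)
open import Data.Fin.Properties as Fin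
  using (join-splitAt; punchIn-punchOut; injective⇒≤; _≟_)
open import Data.Nat.Base as ℕ using (ℕ; zero; suc; z≤n; s≤s)
import Data.Nat.Properties as ℕ
open import Data.Product.Base using (Σ; ∃; ∃-syntax; _,_; proj₁; proj₂)
open import Data.Sum.Base as Sum using (_⊎_; inj₁; inj₂)
open import Data.Vec.Functional using (Vector; _++_)
open import Data.Vec.Functional.Properties using (lookup-++ˡ; lookup-++ʳ)
open import Function.Base using (_∘_; case_of_)
open import Function.Bundles using (Bijection; Inverse)
open import Function.Construct.Composition using (inverse)
open import Function.Construct.Symmetry using () renaming (inverse to flipInverse)
open import Function.Properties.Bijection using (Bijection⇒Inverse)
open import Level using (Level; Lift; lift; lower; _⊔_)
open import Relation.Binary.Bundles using (Setoid)
open import Relation.Binary.PropositionalEquality as ≡ using (_≢_)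
import Relation.Binary.Reasoning.Setoid as SetoidReasoning
open import Relation.Binary.Construct.Add.Supremum.NonStrict ℕ._≤_
  using (_≤⊤⁺) renaming ([_] to [_]≤)
open import Relation.Nullary using (¬_; yes; no)
open import Relation.Nullary.Decidable using (decidable-stable)
open import Relation.Unary using (Pred; _⊆_)

private
  variable
    a p r v e : Level

-- Least indices, values in ℕ ∪ {∞}, and counting

least : Classical → ∀ {k} (Q : Pred (Fin k) p) → ∃ Q →
        ∃[ i ] Q i × (∀ j → Q j → i Fin.≤ j)
least em {zero}  Q (() , _)
least em {suc k} Q (i , q) with em _ {Q Fin.zero}
... | yes q₀ = Fin.zero , q₀ , λ _ _ → z≤n
... | no ¬q₀ with least em (Q ∘ Fin.suc) (tail i q)
  where
  tail : ∀ i → Q i → ∃ (Q ∘ Fin.suc)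
  tail Fin.zero    q = ⊥-elim (¬q₀ q)
  tail (Fin.suc i) q = i , q
...   | j , qⱼ , min = Fin.suc j , qⱼ , λ where
  Fin.zero    q → ⊥-elim (¬q₀ q)
  (Fin.suc l) q → s≤s (min l q)

the≡[] : (em : Classical) (P : Pred ℕ p) {n : ℕ} → P n → (∀ k → P k → k ≡ n) →
         the em P ≡ [ n ]
the≡[] em P {n} pn unique with em _ {∃ P}
... | yes (k , pk) = ≡.cong [_] (unique k pk)
... | no none      = ⊥-elim (none (n , pn))

the≡∞ : (em : Classical) (P : Pred ℕ p) → ¬ ∃ P → the em P ≡ ∞
the≡∞ em P none with em _ {∃ P}
... | yes some = ⊥-elim (none some)
... | no _     = ≡.refl

module _ (em : Classical) (S : Setoid a r) where
  open Setoid S using (_≈_) renaming (Carrier to A)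

  Enumeration : ℕ → Set _
  Enumeration n = Inverse (≡.setoid (Fin n)) S

  Distinct : ℕ → Set _
  Distinct n = Σ (Vector A n) λ f → ∀ i j → i ≢ j → ¬ f i ≈ f j

  enumeration : ∀ {n} (f : Vector A n) → (∀ {i j} → f i ≈ f j → i ≡ j) →
                (∀ s → ∃[ i ] f i ≈ s) → Enumeration n
  enumeration f inj surj = Bijection⇒Inverse (record
    { to        = f
    ; cong      = λ { ≡.refl → Setoid.refl S }
    ; bijective = inj , λ s → proj₁ (surj s) , λ { ≡.refl → proj₂ (surj s) }
    })

  card≡[] : ∀ {n} → Enumeration n → card em S ≡ [ n ]
  card≡[] {n} f = the≡[] em Enumeration f λ k g → ℕ.≤-antisym
    (Inverse⇒≤ (inverse g (flipInverse f)))
    (Inverse⇒≤ (inverse f (flipInverse g)))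
    where
    Inverse⇒≤ : ∀ {k l} → Inverse (≡.setoid (Fin k)) (≡.setoid (Fin l)) → k ℕ.≤ l
    Inverse⇒≤ h = injective⇒≤ {f = Inverse.to h} λ {x} {y} eq →
      ≡.trans (≡.sym (Inverse.strictlyInverseʳ h x))
        (≡.trans (≡.cong (Inverse.from h) eq) (Inverse.strictlyInverseʳ h y))

  -- A list of distinct elements that nothing extends meets every class, so it would be an
  -- enumeration.
  arbitrarilyManyDistinct : ¬ ∃ Enumeration → ∀ n → Distinct n
  arbitrarilyManyDistinct inf zero = (λ ()) , λ ()
  arbitrarilyManyDistinct inf (suc n)
    with arbitrarilyManyDistinct inf n
  ... | f , dist with em _ {∃[ s ] (∀ i → ¬ f i ≈ s)}
  ...   | yes (s , new) = f⁺ , dist⁺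
    where
    f⁺ : Vector A (suc n)
    f⁺ Fin.zero    = s
    f⁺ (Fin.suc i) = f i
    dist⁺ : ∀ i j → i ≢ j → ¬ f⁺ i ≈ f⁺ j
    dist⁺ Fin.zero    Fin.zero    i≢j eq = i≢j ≡.refl
    dist⁺ Fin.zero    (Fin.suc j) i≢j eq = new j (Setoid.sym S eq)
    dist⁺ (Fin.suc i) Fin.zero    i≢j eq = new i eq
    dist⁺ (Fin.suc i) (Fin.suc j) i≢j eq = dist i j (i≢j ∘ ≡.cong Fin.suc) eq
  ...   | no onto = ⊥-elim (inf (n , enumeration f
            (λ {i} {j} eq → decidable-stable (i ≟ j) λ i≢j → dist i j i≢j eq)
            (λ s → decidable-stable (em _) λ none → onto (s , λ i eq → none (i , eq)))))

  distinct : ∀ {n} → Enumeration n → Distinct n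
  distinct f = Inverse.to f , λ i j i≢j eq → i≢j
    (≡.trans (≡.sym (Inverse.strictlyInverseʳ f i))
      (≡.trans (Inverse.from-cong f eq) (Inverse.strictlyInverseʳ f j)))

-- Cliques and colourings

module _ (em : Classical) (G : SimpleGraph v r e) where
  open SimpleGraph G

  clique≤colours : ∀ {m n} → HasClique G m → Colourable G n → m ℕ.≤ n
  clique≤colours (f , adj) (c , proper) = injective⇒≤ λ {i} {j} eq →
    decidable-stable (i ≟ j) λ i≢j → proper (adj i j i≢j) eq

  -- No clique has more vertices than a proper colouring has colours, so a clique and a colouring of
  -- equal size are both optimal.
  ω-χ≡[] : ∀ {n} → HasClique G n → Colourable G n →
           cliqueNumber em G ≡ [ n ] × chromaticNumber em G ≡ [ n ]
  ω-χ≡[] {n} cl co =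
    the≡[] em _ (cl , λ m cl′ → clique≤colours cl′ co)
      (λ m (cl′ , max) → ℕ.≤-antisym (clique≤colours cl′ co) (max n cl)) ,
    the≡[] em _ (co , λ m co′ → clique≤colours cl co′)
      (λ m (co′ , min) → ℕ.≤-antisym (min n co) (clique≤colours cl co′))

  ω-χ≡∞ : (∀ n → HasClique G n) →
          cliqueNumber em G ≡ ∞ × chromaticNumber em G ≡ ∞
  ω-χ≡∞ cl =
    the≡∞ em _ (λ (n , _ , max) → ℕ.1+n≰n (max (suc n) (cl (suc n)))) ,
    the≡∞ em _ (λ (n , co , _) → ℕ.1+n≰n (clique≤colours (cl (suc n)) co))

  -- Taking the least admissible colour makes the choice independent of the
  -- representative of a vertex.
  colourable : ∀ {q k} (Q : Vertex → Pred (Fin k) q) →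
    (∀ {x y} i → x ≈ⱽ y → Q x i → Q y i) → (∀ x → ∃ (Q x)) →
    (∀ {x y} i → x ~ y → Q x i → ¬ Q y i) → Colourable G k
  colourable Q Q-resp total proper = record
    { to   = colour
    ; cong = λ {x} {y} x≈y → Fin.≤-antisym (mono x≈y) (mono (Setoid.sym vertices x≈y))
    } , λ {x} {y} x~y same → proper (colour x) x~y (admissible x)
          (≡.subst (Q y) (≡.sym same) (admissible y))
    where
    colour : Vertex → Fin _
    colour x = proj₁ (least em (Q x) (total x))
    admissible : ∀ x → Q x (colour x)
    admissible x = proj₁ (proj₂ (least em (Q x) (total x)))
    mono : ∀ {x y} → x ≈ⱽ y → colour x Fin.≤ colour y
    mono {x} {y} x≈y = proj₂ (proj₂ (least em (Q x) (total x))) (colour y)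
      (Q-resp _ (Setoid.sym vertices x≈y) (admissible y))

-- Ideals and primes

module _ (em : Classical) {c ℓ : Level} (R : CommutativeRing c ℓ) where
  open CommutativeRing R hiding (zero)
  open Exp semiring using (_^_; ^-homo-*)
  open SetoidReasoning setoid
  open Ideal using (Mem)

  private
    Id : Set (Level.suc (c ⊔ ℓ))
    Id = Ideal R

    dne : ∀ {a} {A : Set a} → ¬ ¬ A → A
    dne = decidable-stable (em _)

    rotate : ∀ x y z → x * (y * z) ≈ y * (x * z)
    rotate x y z = trans (sym (*-assoc x y z)) (trans (*-congʳ (*-comm x y)) (*-assoc y x z))

  ¬⊆⇒∃ : ∀ {p q} {P : Pred Carrier p} {Q : Pred Carrier q} →
         ¬ (P ⊆ Q) → ∃[ x ] P x × ¬ Q x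
  ¬⊆⇒∃ P⊈Q = dne λ none → P⊈Q λ {x} x∈P → dne λ x∉Q → none (x , x∈P , x∉Q)

  Span-least : ∀ {S} (I : Id) → S ⊆ Mem I → Span R S ⊆ Mem I
  Span-least I S⊆I (gen s)    = S⊆I s
  Span-least I S⊆I (resp e p) = Ideal.respects I e (Span-least I S⊆I p)
  Span-least I S⊆I zero′      = Ideal.0∈ I
  Span-least I S⊆I (add p q)  = Ideal.+-closed I (Span-least I S⊆I p) (Span-least I S⊆I q)
  Span-least I S⊆I (mul r p)  = Ideal.*-closed I r (Span-least I S⊆I p)

  -- The ideal quotient (I : S). Taking a predicate for `S` covers both a single element and an
  -- ideal.
  colon : Id → Pred Carrier (c ⊔ ℓ) → Id
  colon I S = record
    { Mem      = λ x → ∀ {y} → S y → Mem I (x * y)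
    ; respects = λ x≈x′ h s → Ideal.respects I (*-congʳ x≈x′) (h s)
    ; 0∈       = λ {y} _ → Ideal.respects I (sym (zeroˡ y)) (Ideal.0∈ I)
    ; +-closed = λ h h′ s → Ideal.respects I (sym (distribʳ _ _ _))
                              (Ideal.+-closed I (h s) (h′ s))
    ; *-closed = λ r h s → Ideal.respects I (sym (*-assoc r _ _))
                             (Ideal.*-closed I r (h s))
    }

  ⋂ : ∀ {n} → Vector Id n → Id
  ⋂ f = record
    { Mem      = λ x → ∀ i → Mem (f i) x
    ; respects = λ x≈y h i → Ideal.respects (f i) x≈y (h i)
    ; 0∈       = λ i → Ideal.0∈ (f i)
    ; +-closed = λ h h′ i → Ideal.+-closed (f i) (h i) (h′ i)
    ; *-closed = λ r h i → Ideal.*-closed (f i) r (h i)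
    }

  principal : Carrier → Id
  principal x = record
    { Mem      = λ z → ∃[ r ] z ≈ r * x
    ; respects = λ y≈z (r , y≈rx) → r , trans (sym y≈z) y≈rx
    ; 0∈       = 0# , sym (zeroˡ x)
    ; +-closed = λ (r , p) (s , q) → r + s , trans (+-cong p q) (sym (distribʳ x r s))
    ; *-closed = λ s (r , p) → s * r , trans (*-congˡ p) (sym (*-assoc s r x))
    }

  annihilator : Carrier → Id
  annihilator x = record
    { Mem      = λ z → Lift c (z * x ≈ 0#)
    ; respects = λ y≈z (lift p) → lift (trans (*-congʳ (sym y≈z)) p)
    ; 0∈       = lift (zeroˡ x)
    ; +-closed = λ (lift p) (lift q) → lift (trans (distribʳ x _ _)
                   (trans (+-cong p q) (+-identityˡ 0#)))
    ; *-closed = λ r (lift p) → lift (trans (*-assoc r _ x) (trans (*-congˡ p) (zeroʳ r)))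
    }

  nonZero : (I : Id) → (∃[ x ] Mem I x × ¬ x ≈ 0#) → NonZero R I
  nonZero I (x , x∈I , x≉0) (I⊆0 , _) = x≉0 (lower (I⊆0 x∈I))

  nonZero⇒∃ : (I : Id) → NonZero R I → ∃[ x ] Mem I x × ¬ x ≈ 0#
  nonZero⇒∃ I I≢0 = case ¬⊆⇒∃ {P = Mem I} {Q = Mem (zeroIdeal R)}
    (λ I⊆0 → I≢0 (I⊆0 , λ (lift x≈0) → Ideal.respects I (sym x≈0) (Ideal.0∈ I)))
    of λ (x , x∈I , x∉0) → x , x∈I , x∉0 ∘ lift

  ^∈prime⇒∈ : (P : Id) → IsPrime R P → ∀ {x} n → Mem P (x ^ n) → Mem P x
  ^∈prime⇒∈ P (1∉P , _) zero    1∈P = ⊥-elim (1∉P 1∈P)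
  ^∈prime⇒∈ P prime@(_ , split) (suc n) xxⁿ∈P with split xxⁿ∈P
  ... | inj₁ x∈P  = x∈P
  ... | inj₂ xⁿ∈P = ^∈prime⇒∈ P prime n xⁿ∈P

  Nil⊆prime : (P : Id) → IsPrime R P → Nil R ⊆ Mem P
  Nil⊆prime P prime (n , xⁿ≈0) =
    ^∈prime⇒∈ P prime n (Ideal.respects P (sym xⁿ≈0) (Ideal.0∈ P))

  -- Choose an element of each `f i` outside `Q`. Their product lies in every `f i`, and primality
  -- keeps it outside `Q`; the empty product is 1.
  primeAvoidance : ∀ {n} (Q : Id) → IsPrime R Q → (f : Vector Id n) →
    (∀ i → ¬ (Mem (f i) ⊆ Mem Q)) → ∃[ x ] Mem (⋂ f) x × ¬ Mem Q x
  primeAvoidance {zero} Q (1∉Q , _) f f⊈Q = 1# , (λ ()) , 1∉Q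
  primeAvoidance {suc n} Q prime f f⊈Q
    with ¬⊆⇒∃ (f⊈Q Fin.zero) | primeAvoidance Q prime (f ∘ Fin.suc) (f⊈Q ∘ Fin.suc)
  ... | x , x∈f , x∉Q | y , y∈f , y∉Q = x * y ,
    (λ where
      Fin.zero    → Ideal.respects (f Fin.zero) (*-comm y x) (Ideal.*-closed (f Fin.zero) y x∈f)
      (Fin.suc i) → Ideal.*-closed (f (Fin.suc i)) x (y∈f i)) ,
    λ xy∈Q → Sum.[ x∉Q , y∉Q ]′ (proj₂ prime xy∈Q)

  -- The ascending chain condition

  module _ (noetherian : Noetherian R) where

    -- A family without such a member would give a strictly increasing chain,
    -- whose union is not finitely generated.
    maximal : {A : Set a} (F : A → Id) → A →
              ∃[ x ] (∀ y → Mem (F x) ⊆ Mem (F y) → Mem (F y) ⊆ Mem (F x))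
    maximal {A = A} F x₀ = dne λ none → absurd λ x → dne λ no-larger →
      none (x , λ y x⊆y → dne λ y⊈x → no-larger (y , x⊆y , y⊈x))
      where
      module _ (larger : ∀ x → ∃[ y ] Mem (F x) ⊆ Mem (F y) × ¬ (Mem (F y) ⊆ Mem (F x))) where
        chain : ℕ → A
        chain zero    = x₀
        chain (suc n) = proj₁ (larger (chain n))

        mono : ∀ {m n} → m ℕ.≤′ n → Mem (F (chain m)) ⊆ Mem (F (chain n))
        mono (ℕ.≤′-reflexive ≡.refl) x∈ = x∈
        mono (ℕ.≤′-step m≤n)         x∈ = proj₁ (proj₂ (larger _)) (mono m≤n x∈)

        union : Id
        union = record
          { Mem      = λ x → ∃[ n ] Mem (F (chain n)) x
          ; respects = λ x≈y (n , x∈) → n , Ideal.respects (F (chain n)) x≈y x∈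
          ; 0∈       = 0 , Ideal.0∈ (F x₀)
          ; +-closed = λ (m , x∈) (n , y∈) → m ℕ.⊔ n , Ideal.+-closed (F (chain (m ℕ.⊔ n)))
              (mono (ℕ.≤⇒≤′ (ℕ.m≤m⊔n m n)) x∈) (mono (ℕ.≤⇒≤′ (ℕ.m≤n⊔m m n)) y∈)
          ; *-closed = λ r (n , x∈) → n , Ideal.*-closed (F (chain n)) r x∈
          }

        bound : ∀ {k} (g : Vector Carrier k) → (∀ i → Mem union (g i)) →
                ∃[ n ] (∀ i → Mem (F (chain n)) (g i))
        bound {zero}  g g∈ = 0 , λ ()
        bound {suc k} g g∈ with g∈ Fin.zero | bound (g ∘ Fin.suc) (g∈ ∘ Fin.suc)
        ... | m , g₀∈ | n , gₛ∈ = m ℕ.⊔ n , λ where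
          Fin.zero    → mono (ℕ.≤⇒≤′ (ℕ.m≤m⊔n m n)) g₀∈
          (Fin.suc i) → mono (ℕ.≤⇒≤′ (ℕ.m≤n⊔m m n)) (gₛ∈ i)

        absurd : _
        absurd with noetherian union
        ... | k , g , union⊆⟨g⟩ , ⟨g⟩⊆union
          with bound g (λ i → ⟨g⟩⊆union (gen (lift (i , refl))))
        -- All generators of the union already lie in the ideal at stage `n`, so the next stage is
        -- no larger.
        ...   | n , g∈ = proj₂ (proj₂ (larger (chain n))) λ x∈ →
          Span-least (F (chain n))
            (λ (lift (i , x≈gᵢ)) → Ideal.respects (F (chain n)) (sym x≈gᵢ) (g∈ i))
            (union⊆⟨g⟩ (suc n , x∈))

    -- Nilpotents, annihilators and essentiality

    -- Choose y with maximal annihilator among the non-zero elements of K.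
    nilpotentsKill : (K : Id) → NonZero R K →
      ∃[ y ] Mem K y × ¬ y ≈ 0# × (∀ {x} → Nil R x → x * y ≈ 0#)
    nilpotentsKill K K≢0 with maximal {A = ∃[ y ] Mem K y × ¬ y ≈ 0#}
                                (annihilator ∘ proj₁) (nonZero⇒∃ K K≢0)
    ... | (y , y∈K , y≉0) , max = y , y∈K , y≉0 , λ {x} (n , xⁿ≈0) → dne λ xy≉0 →
      descend x (cancel x xy≉0) n (trans (*-congʳ xⁿ≈0) (zeroˡ y))
      where
      -- Ann(y) ⊆ Ann(xy) always holds, so maximality gives equality as soon as xy is non-zero.
      cancel : ∀ x → ¬ x * y ≈ 0# → ∀ z → z * (x * y) ≈ 0# → z * y ≈ 0#
      cancel x xy≉0 z zxy≈0 = lower (max (x * y , Ideal.*-closed K x y∈K , xy≉0)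
        (λ {w} (lift wy≈0) → lift (trans (rotate w x y) (trans (*-congˡ wy≈0) (zeroʳ x))))
        (lift zxy≈0))

      -- Cancelling the factors of `x ^ n` one at a time would leave y = 0.
      descend : ∀ x → (∀ z → z * (x * y) ≈ 0# → z * y ≈ 0#) → ∀ n → ¬ x ^ n * y ≈ 0#
      descend x cancel zero    eq = y≉0 (trans (sym (*-identityˡ y)) eq)
      descend x cancel (suc n) eq = descend x cancel n (cancel (x ^ n)
        (trans (rotate (x ^ n) x y) (trans (sym (*-assoc x (x ^ n) y)) eq)))

    -- The ideals Ann(bⁿ) increase with n, so a maximal one equals its successor. Multiplication by
    -- b is then injective on (bⁿ).
    annihilatorOfPowersStabilises : ∀ b →
      ∃[ n ] (∀ z → b * (z * b ^ n) ≈ 0# → z * b ^ n ≈ 0#)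
    annihilatorOfPowersStabilises b with maximal (λ n → annihilator (b ^ n)) 0
    ... | n , max = n , λ z eq → lower (max (suc n)
      (λ {w} (lift wbⁿ≈0) → lift (trans (rotate w b (b ^ n)) (trans (*-congˡ wbⁿ≈0) (zeroʳ b))))
      (lift (trans (rotate z b (b ^ n)) eq)))

    -- Take a non-zero y in (bⁿ) killed by all nilpotents. For x in `A`, b(xy) = (bx)y = 0, and b
    -- can be cancelled because xy lies in (bⁿ).
    annihilator≢0 : (A : Id) {b : Carrier} → ¬ Nil R b →
      (∀ {x} → Mem A x → Nil R (b * x)) → NonZero R (Ann R A)
    annihilator≢0 A {b} b∉Nil bA⊆Nil =
      let n , cancel = annihilatorOfPowersStabilises b
          y , (s , y≈sbⁿ) , y≉0 , kill = nilpotentsKill (principal (b ^ n))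
            (nonZero (principal (b ^ n))
               (b ^ n , (1# , sym (*-identityˡ _)) , λ bⁿ≈0 → b∉Nil (n , bⁿ≈0)))
      in nonZero (Ann R A) (y , killsA cancel y≈sbⁿ kill , y≉0)
      where
      killsA : ∀ {y s z} → (∀ w → b * (w * z) ≈ 0# → w * z ≈ 0#) → y ≈ s * z →
               (∀ {x} → Nil R x → x * y ≈ 0#) → ∀ {x} → Mem A x → y * x ≈ 0#
      killsA {y} {s} {z} cancel y≈sz kill {x} x∈A =
        trans yx≈ (cancel (x * s) (begin
          b * ((x * s) * z) ≈⟨ *-congˡ yx≈ ⟨
          b * (y * x)       ≈⟨ *-congˡ (*-comm y x) ⟩
          b * (x * y)       ≈⟨ *-assoc b x y ⟨
          b * x * y         ≈⟨ kill (bA⊆Nil x∈A) ⟩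
          0#                ∎))
        where
        yx≈ : y * x ≈ (x * s) * z
        yx≈ = trans (*-comm y x) (trans (*-congˡ y≈sz) (sym (*-assoc x s z)))

    -- If xy were not nilpotent, Ann(IJ) would contain a non-zero z in the ideal of a stable power
    -- of xy. But xy kills z and is cancellable on that ideal.
    essentialAnn⇒nil : (I J : Id) → Essential R (Ann R (_·_ R I J)) →
      ∀ {x y} → Mem I x → Mem J y → Nil R (x * y)
    essentialAnn⇒nil I J (_ , ess) {x} {y} x∈I y∈J = dne λ xy∉Nil →
      let n , cancel = annihilatorOfPowersStabilises (x * y)
          K = principal ((x * y) ^ n)
          K≢0 = nonZero K ((x * y) ^ n , (1# , sym (*-identityˡ _)) , λ eq → xy∉Nil (n , eq))
          z , (z∈Ann , (s , z≈)) , z≉0 =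
            nonZero⇒∃ (_∩ᴵ_ R (Ann R (_·_ R I J)) K) (ess K K≢0)
          xyz≈0 = trans (*-comm (x * y) z) (z∈Ann (gen (x , y , x∈I , y∈J , refl)))
      in z≉0 (trans z≈ (cancel s (trans (*-congˡ (sym z≈)) xyz≈0)))

    -- Prime decomposition and the minimal primes

    -- Noetherian induction: if x y ∈ I with x, y ∉ I, then (I : x) and
    -- (I : (I : x)) are strictly larger than I and their product lies in I.
    radicalAsIntersection : (I : Id) → ∃[ n ] Σ (Vector Id n) λ f →
      (∀ i → IsPrime R (f i)) × (∀ {x} → Mem (⋂ f) x → ∃[ k ] Mem I (x ^ k))
    radicalAsIntersection I₀ = dne λ bad →
      let (I , ¬decI) , max = maximal {A = ∃[ I ] ¬ Decomposable I} proj₁ (I₀ , bad)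
      in ¬decI (decompose I λ J I⊆J J⊈I → dne λ ¬decJ → J⊈I (max (J , ¬decJ) I⊆J))
      where
      Decomposable : Id → Set _
      Decomposable I = ∃[ n ] Σ (Vector Id n) λ f →
        (∀ i → IsPrime R (f i)) × (∀ {x} → Mem (⋂ f) x → ∃[ k ] Mem I (x ^ k))

      decompose : ∀ I → (∀ J → Mem I ⊆ Mem J → ¬ (Mem J ⊆ Mem I) → Decomposable J) →
                  Decomposable I
      decompose I ih with em _ {Mem I 1#}
      -- The unit ideal is the intersection of the empty family, and every zeroth power is 1.
      ... | yes 1∈I = 0 , (λ ()) , (λ ()) , λ _ → 0 , 1∈I
      ... | no 1∉I with em _ {∃[ x ] ∃[ y ] Mem I (x * y) × ¬ Mem I x × ¬ Mem I y}
      ...   | no prime = 1 , (λ _ → I) ,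
              (λ _ → 1∉I , λ {x} {y} xy∈I → dne λ neither →
                prime (x , y , xy∈I , neither ∘ inj₁ , neither ∘ inj₂)) ,
              λ {x} x∈I → 1 , Ideal.respects I (sym (*-identityʳ x)) (x∈I Fin.zero)
      ...   | yes (x , y , xy∈I , x∉I , y∉I)
        with ih J I⊆J (λ J⊆I → y∉I (J⊆I y∈J)) | ih K I⊆K (λ K⊆I → x∉I (K⊆I x∈K))
        where
        J = colon I (λ z → Lift c (z ≈ x))
        K = colon I (Mem J)
        I⊆J : Mem I ⊆ Mem J
        I⊆J {z} z∈I {w} _ = Ideal.respects I (*-comm w z) (Ideal.*-closed I w z∈I)
        I⊆K : Mem I ⊆ Mem K
        I⊆K {z} z∈I {w} _ = Ideal.respects I (*-comm w z) (Ideal.*-closed I w z∈I)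
        y∈J : Mem J y
        y∈J (lift z≈x) = Ideal.respects I (trans (*-comm x y) (*-congˡ (sym z≈x))) xy∈I
        x∈K : Mem K x
        x∈K {w} w∈J = Ideal.respects I (*-comm w x) (w∈J (lift refl))
      ...     | m , f , f-prime , f-nil | n , g , g-prime , g-nil =
        m ℕ.+ n , f ++ g , prime , λ {z} z∈ →
          let k , zᵏ∈J = f-nil (λ i → ≡.subst (λ P → Mem P z) (lookup-++ˡ f g i) (z∈ (i Fin.↑ˡ n)))
              l , zˡ∈K = g-nil (λ i → ≡.subst (λ P → Mem P z) (lookup-++ʳ f g i) (z∈ (m Fin.↑ʳ i)))
          -- zˡ lies in (I : J) and zᵏ in J, so their product lies in I.
          in l ℕ.+ k , Ideal.respects I (sym (^-homo-* z l k)) (zˡ∈K zᵏ∈J)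
        where
        prime : ∀ i → IsPrime R ((f ++ g) i)
        prime i with splitAt m i
        ... | inj₁ i = f-prime i
        ... | inj₂ i = g-prime i

    -- A prime that contains another member of the family is dropped from it.
    abstract
      primeAntichain : ∃[ n ] Σ (Vector Id n) λ f → (∀ i → IsPrime R (f i)) ×
        (Mem (⋂ f) ⊆ Nil R) × (∀ i j → Mem (f i) ⊆ Mem (f j) → i ≡ j)
      primeAntichain =
        let n , f , prime , nil = radicalAsIntersection (zeroIdeal R)
        in prune n f prime λ x∈ → case nil x∈ of λ (k , lift eq) → k , eq
        where
        prune : ∀ n (f : Vector Id n) → (∀ i → IsPrime R (f i)) → Mem (⋂ f) ⊆ Nil R →
          ∃[ n ] Σ (Vector Id n) λ f → (∀ i → IsPrime R (f i)) ×
          (Mem (⋂ f) ⊆ Nil R) × (∀ i j → Mem (f i) ⊆ Mem (f j) → i ≡ j)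
        prune zero f prime nil = zero , f , prime , nil , λ ()
        prune (suc n) f prime nil
          with em _ {∃[ i ] ∃[ j ] j ≢ i × Mem (f i) ⊆ Mem (f j)}
        ... | no antichain = suc n , f , prime , nil , λ i j fᵢ⊆fⱼ →
                decidable-stable (i ≟ j) λ i≢j → antichain (i , j , i≢j ∘ ≡.sym , fᵢ⊆fⱼ)
        ... | yes (i , j , j≢i , fᵢ⊆fⱼ) =
                prune n (f ∘ punchIn j) (prime ∘ punchIn j) (nil ∘ restore)
          where
          other : ∀ {x} → Mem (⋂ (f ∘ punchIn j)) x → ∀ k → j ≢ k → Mem (f k) x
          other {x} x∈ k j≢k =
            ≡.subst (λ l → Mem (f l) x) (punchIn-punchOut j≢k) (x∈ (punchOut j≢k))
          restore : Mem (⋂ (f ∘ punchIn j)) ⊆ Mem (⋂ f)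
          restore x∈ k with j ≟ k
          ... | yes ≡.refl = fᵢ⊆fⱼ (other x∈ i j≢i)
          ... | no j≢k     = other x∈ k j≢k

    m : ℕ
    m = proj₁ primeAntichain

    P : Vector Id m
    P = proj₁ (proj₂ primeAntichain)

    P-prime : ∀ i → IsPrime R (P i)
    P-prime = proj₁ (proj₂ (proj₂ primeAntichain))

    ⋂P⊆Nil : Mem (⋂ P) ⊆ Nil R
    ⋂P⊆Nil = proj₁ (proj₂ (proj₂ (proj₂ primeAntichain)))

    P-antichain : ∀ i j → Mem (P i) ⊆ Mem (P j) → i ≡ j
    P-antichain = proj₂ (proj₂ (proj₂ (proj₂ primeAntichain)))

    Nil⊆⋂P : Nil R ⊆ Mem (⋂ P)
    Nil⊆⋂P x∈Nil i = Nil⊆prime (P i) (P-prime i) x∈Nil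

    -- Since `Nil R` is the intersection of the `P i`, this and the next two laws are inherited from
    -- ideals and primes.
    Nil-resp : ∀ {x y} → x ≈ y → Nil R x → Nil R y
    Nil-resp x≈y x∈Nil = ⋂P⊆Nil (Ideal.respects (⋂ P) x≈y (Nil⊆⋂P x∈Nil))

    Nil-*ˡ : ∀ x {y} → Nil R y → Nil R (x * y)
    Nil-*ˡ x y∈Nil = ⋂P⊆Nil (Ideal.*-closed (⋂ P) x (Nil⊆⋂P y∈Nil))

    Nil-square : ∀ {x} → Nil R (x * x) → Nil R x
    Nil-square xx∈Nil = ⋂P⊆Nil λ i → Sum.reduce (proj₂ (P-prime i) (Nil⊆⋂P xx∈Nil i))

    -- Otherwise some element of the intersection of the `P i` avoids `Q`, although it is nilpotent.
    everyPrimeContainsSomeP : (Q : Id) → IsPrime R Q → ∃[ i ] Mem (P i) ⊆ Mem Q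
    everyPrimeContainsSomeP Q prime = dne λ none →
      let x , x∈ , x∉Q = primeAvoidance Q prime P (λ i Pᵢ⊆Q → none (i , λ {x} → Pᵢ⊆Q {x}))
      in x∉Q (Nil⊆prime Q prime (⋂P⊆Nil x∈))

    -- A prime inside `P i` contains some `P j`, and the antichain condition forces j = i.
    P-minimal : ∀ i → IsMinimalPrime R (P i)
    P-minimal i = P-prime i , λ Q prime Q⊆Pᵢ → Q⊆Pᵢ ,
      (case everyPrimeContainsSomeP Q prime of λ (j , Pⱼ⊆Q) →
        ≡.subst (λ k → Mem (P k) ⊆ Mem Q) (P-antichain j i (λ x∈ → Q⊆Pᵢ (Pⱼ⊆Q x∈))) Pⱼ⊆Q)

    ∣Min∣≡ : card em (Min R) ≡ [ m ]
    ∣Min∣≡ = card≡[] em (Min R) (enumeration em (Min R) (λ i → P i , P-minimal i)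
      (λ {i} {j} (Pᵢ⊆Pⱼ , _) → P-antichain i j Pᵢ⊆Pⱼ)
      (λ (Q , prime , min) → case everyPrimeContainsSomeP Q prime of λ (i , Pᵢ⊆Q) →
        i , min (P i) (P-prime i) Pᵢ⊆Q))

    -- Adjacency and cliques

    private
      V : Set _
      V = SimpleGraph.Vertex (EG R)

      open SimpleGraph (EG R) using (_~_)

      _⊆Nil : V → Set _
      (I , _) ⊆Nil = Mem I ⊆ Nil R

    -- IJ consists of nilpotents, so every non-zero ideal contains a non-zero element that IJ kills.
    adjacent : (v w : V) → ¬ (_≈ᴵ_ R (proj₁ v) (proj₁ w)) →
      (∀ {x y} → Mem (proj₁ v) x → Mem (proj₁ w) y → Nil R (x * y)) → v ~ w
    adjacent (I , _ , I≢0) (J , _) I≉J nil = I≉J ,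
      -- That Ann(IJ) is itself non-zero follows by testing it against `I`, a non-zero ideal.
      nonZero Ann[IJ] (case meet I I≢0 of λ (y , (y∈Ann , _) , y≉0) →
        y , (λ {x} → y∈Ann {x}) , y≉0) ,
      λ K K≢0 → nonZero (_∩ᴵ_ R Ann[IJ] K) (meet K K≢0)
      where
      Ann[IJ] = Ann R (_·_ R I J)
      IJ⊆Nil : Mem (_·_ R I J) ⊆ Nil R
      IJ⊆Nil x∈IJ = ⋂P⊆Nil (Span-least (⋂ P)
        (λ (x , y , x∈I , y∈J , eq) → Nil⊆⋂P (Nil-resp (sym eq) (nil x∈I y∈J))) x∈IJ)
      meet : ∀ K → NonZero R K → ∃[ y ] Mem (_∩ᴵ_ R Ann[IJ] K) y × ¬ y ≈ 0#
      meet K K≢0 = case nilpotentsKill K K≢0 of λ (y , y∈K , y≉0 , kill) →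
        y , ((λ {x} x∈IJ → trans (*-comm y x) (kill (IJ⊆Nil x∈IJ))) , y∈K) , y≉0

    -- Members of `𝒜` are adjacent to every other vertex, so only pairs within `g` need a condition
    -- on products.
    clique : ∀ {k n} (g : Vector V k) → (∀ i → ¬ g i ⊆Nil) →
      (∀ i j → i ≢ j → ∀ {x y} → Mem (proj₁ (g i)) x → Mem (proj₁ (g j)) y → Nil R (x * y)) →
      Distinct em (𝒜 R) n → HasClique (EG R) (k ℕ.+ n)
    clique {k} {n} g g⊈Nil gg⊆Nil (h , h-distinct) = f ∘ splitAt k , λ i j i≢j →
      adj (splitAt k i) (splitAt k j) λ eq → i≢j
        (≡.trans (≡.sym (join-splitAt k n i)) (≡.trans (≡.cong (join k n) eq) (join-splitAt k n j)))
      where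
      f : Fin k ⊎ Fin n → V
      f (inj₁ i) = g i
      f (inj₂ i) = proj₁ (h i) , proj₁ (proj₂ (h i))

      h⊆Nil : ∀ i → Mem (proj₁ (h i)) ⊆ Nil R
      h⊆Nil i = proj₂ (proj₂ (h i))

      adj : ∀ s t → s ≢ t → f s ~ f t
      adj (inj₁ i) (inj₁ j) s≢t = adjacent (g i) (g j)
        -- If the two ideals coincided, the square of each element would be nilpotent, and hence the
        -- element too.
        (λ (gᵢ⊆gⱼ , _) → g⊈Nil i λ x∈ →
          Nil-square (gg⊆Nil i j (s≢t ∘ ≡.cong inj₁) x∈ (gᵢ⊆gⱼ x∈)))
        (gg⊆Nil i j (s≢t ∘ ≡.cong inj₁))
      adj s@(inj₁ i) t@(inj₂ j) s≢t = adjacent (f s) (f t)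
        (λ (gᵢ⊆hⱼ , _) → g⊈Nil i λ x∈ → h⊆Nil j (gᵢ⊆hⱼ x∈))
        (λ {x} _ y∈ → Nil-*ˡ x (h⊆Nil j y∈))
      adj s@(inj₂ i) t@(inj₁ j) s≢t = adjacent (f s) (f t)
        (λ (_ , gⱼ⊆hᵢ) → g⊈Nil j λ x∈ → h⊆Nil i (gⱼ⊆hᵢ x∈))
        (λ {x} {y} x∈ _ → Nil-resp (*-comm y x) (Nil-*ˡ y (h⊆Nil i x∈)))
      adj s@(inj₂ i) t@(inj₂ j) s≢t = adjacent (f s) (f t)
        (h-distinct i j (s≢t ∘ ≡.cong inj₂))
        (λ {x} _ y∈ → Nil-*ˡ x (h⊆Nil j y∈))

    clique-𝒜 : ∀ {n} → Distinct em (𝒜 R) n → HasClique (EG R) n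
    clique-𝒜 = clique {k = 0} (λ ()) (λ ()) (λ ())

    -- Colourings

    module _ {n : ℕ} (𝒜-enum : Enumeration em (𝒜 R) n) where

      private
        A : Fin n → Id
        A = proj₁ ∘ Inverse.to 𝒜-enum

        ∈𝒜⇒≈A : ∀ v → v ⊆Nil → ∃[ i ] (_≈ᴵ_ R (proj₁ v) (A i))
        ∈𝒜⇒≈A (I , vI) I⊆Nil = Inverse.from 𝒜-enum J , (λ {x} → proj₂ eq {x}) , (λ {x} → proj₁ eq {x})
          where
          J = I , vI , λ {x} → I⊆Nil {x}
          eq = Inverse.strictlyInverseˡ 𝒜-enum J

      colourable-𝒜 : (∀ v → v ⊆Nil) → Colourable (EG R) n
      colourable-𝒜 ⊆Nil = colourable em (EG R) (λ (I , _) i → _≈ᴵ_ R I (A i))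
        (λ i (I⊆J , J⊆I) (I⊆A , A⊆I) → (λ x∈ → I⊆A (J⊆I x∈)) , (λ x∈ → I⊆J (A⊆I x∈)))
        (λ v → ∈𝒜⇒≈A v (⊆Nil v))
        (λ i (I≉J , _) (I⊆A , A⊆I) (J⊆A , A⊆J) →
          I≉J ((λ x∈ → A⊆J (I⊆A x∈)) , (λ x∈ → A⊆I (J⊆A x∈))))

      -- Two vertices not contained in `P i` have elements whose product is outside `P i`, hence not
      -- nilpotent, so they are not adjacent and may share the colour i.
      colourable-Min+𝒜 : Colourable (EG R) (m ℕ.+ n)
      colourable-Min+𝒜 = colourable em (EG R) (λ v → Q v ∘ splitAt m)
        (λ i → Q-resp (splitAt m i)) total (λ i → proper (splitAt m i))
        where
        Q : V → Pred (Fin m ⊎ Fin n) (c ⊔ ℓ)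
        Q (I , _) (inj₁ i) = ¬ (Mem I ⊆ Mem (P i))
        Q (I , _) (inj₂ j) = _≈ᴵ_ R I (A j)

        Q-resp : ∀ {v w} s → _≈ᴵ_ R (proj₁ v) (proj₁ w) → Q v s → Q w s
        Q-resp (inj₁ i) (I⊆J , J⊆I) I⊈P J⊆P = I⊈P λ x∈ → J⊆P (I⊆J x∈)
        Q-resp (inj₂ j) (I⊆J , J⊆I) (I⊆A , A⊆I) = (λ x∈ → I⊆A (J⊆I x∈)) , (λ x∈ → I⊆J (A⊆I x∈))

        total : ∀ v → ∃[ i ] Q v (splitAt m i)
        total v with em _ {v ⊆Nil}
        ... | yes v⊆Nil = case ∈𝒜⇒≈A v v⊆Nil of λ (j , eq) →
          m Fin.↑ʳ j , ≡.subst (Q v) (≡.sym (Fin.splitAt-↑ʳ m n j)) eq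
        ... | no v⊈Nil = case dne (λ none → v⊈Nil λ x∈ →
                                ⋂P⊆Nil λ i → dne λ x∉P → none (i , λ v⊆P → x∉P (v⊆P x∈)))
                         of λ (i , v⊈P) →
          i Fin.↑ˡ n , ≡.subst (Q v) (≡.sym (Fin.splitAt-↑ˡ m i n)) v⊈P

        proper : ∀ {v w} s → v ~ w → Q v s → ¬ Q w s
        proper {I , _} {J , _} (inj₁ i) (_ , ess) I⊈P J⊈P =
          let x , x∈I , x∉P = ¬⊆⇒∃ I⊈P
              y , y∈J , y∉P = ¬⊆⇒∃ J⊈P
          in Sum.[ x∉P , y∉P ]′ (proj₂ (P-prime i)
               (Nil⊆⋂P (essentialAnn⇒nil I J ess x∈I y∈J) i))
        proper (inj₂ j) (I≉J , _) (I⊆A , A⊆I) (J⊆A , A⊆J) =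
          I≉J ((λ x∈ → A⊆J (I⊆A x∈)) , (λ x∈ → A⊆I (J⊆A x∈)))

    -- Cliques from the minimal primes

    -- The ideals ⋂_{j ≠ i} P j; omitting P i by weakening the condition at i
    -- keeps the index set.
    weaken : Fin m → Vector Id m
    weaken i j = record
      { Mem      = λ x → j ≢ i → Mem (P j) x
      ; respects = λ x≈y h j≢i → Ideal.respects (P j) x≈y (h j≢i)
      ; 0∈       = λ _ → Ideal.0∈ (P j)
      ; +-closed = λ h h′ j≢i → Ideal.+-closed (P j) (h j≢i) (h′ j≢i)
      ; *-closed = λ r h j≢i → Ideal.*-closed (P j) r (h j≢i)
      }

    -- No `weaken i j` lies in the prime `P i`, so their intersection has an element outside `P i`.
    ⋂weaken⊈Nil : ∀ i → ∃[ x ] Mem (⋂ (weaken i)) x × ¬ Nil R x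
    ⋂weaken⊈Nil i =
      let x , x∈ , x∉P = primeAvoidance (P i) (P-prime i) (weaken i) weaken⊈P
      in x , x∈ , λ x∈Nil → x∉P (Nil⊆⋂P x∈Nil i)
      where
      weaken⊈P : ∀ j → ¬ (Mem (weaken i j) ⊆ Mem (P i))
      weaken⊈P j h with j ≟ i
      -- At the index `i` itself the weakened ideal is the whole ring and contains 1.
      ... | yes j≡i = proj₁ (P-prime i) (h λ j≢i → ⊥-elim (j≢i j≡i))
      ... | no j≢i  = j≢i (P-antichain j i λ x∈ → h λ _ → x∈)

    ⋂weaken-product : ∀ i j → i ≢ j → ∀ {x y} →
      Mem (⋂ (weaken i)) x → Mem (⋂ (weaken j)) y → Nil R (x * y)
    ⋂weaken-product i j i≢j {x} {y} x∈ y∈ = ⋂P⊆Nil λ k → case k ≟ i of λ where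
      (no k≢i)     → Ideal.respects (P k) (*-comm y x) (Ideal.*-closed (P k) y (x∈ k k≢i))
      (yes ≡.refl) → Ideal.*-closed (P k) x (y∈ k i≢j)

    clique-Min+𝒜 : 2 ℕ.≤ m → ∀ {n} → Distinct em (𝒜 R) n → HasClique (EG R) (m ℕ.+ n)
    clique-Min+𝒜 2≤m = clique
      (λ i → ⋂ (weaken i) , annihilated i , nonzero i)
      (λ i ⊆Nil → case ⋂weaken⊈Nil i of λ (x , x∈ , x∉Nil) → x∉Nil (⊆Nil x∈))
      ⋂weaken-product
      where
      another : ∀ {k} → 2 ℕ.≤ k → (i : Fin k) → ∃[ j ] j ≢ i
      another (s≤s (s≤s _)) Fin.zero    = Fin.suc Fin.zero , λ ()
      another (s≤s (s≤s _)) (Fin.suc i) = Fin.zero , λ ()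

      -- A second index j supplies a non-nilpotent b that multiplies this ideal into the nilradical;
      -- this is where 2 ≤ m enters.
      annihilated : ∀ i → NonZero R (Ann R (⋂ (weaken i)))
      annihilated i =
        let j , j≢i        = another 2≤m i
            b , b∈ , b∉Nil = ⋂weaken⊈Nil j
        in annihilator≢0 (⋂ (weaken i)) b∉Nil λ x∈ → ⋂weaken-product j i j≢i b∈ x∈

      nonzero : ∀ i → NonZero R (⋂ (weaken i))
      nonzero i = case ⋂weaken⊈Nil i of λ (x , x∈ , x∉Nil) → nonZero (⋂ (weaken i))
        (x , x∈ , λ x≈0 → x∉Nil (Nil-resp (sym x≈0) (⋂P⊆Nil (Ideal.0∈ (⋂ P)))))

-- The finite and infinite cases

Conclusion : (ω χ ∣Min∣ ∣𝒜∣ : ℕ∞) → Set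
Conclusion ω χ ∣Min∣ ∣𝒜∣ =
  ([ 2 ] ≤∞ ∣Min∣ → ω ≡ χ × χ ≡ ∣Min∣ +∞ ∣𝒜∣)
  ×
  (∣Min∣ ≡ [ 1 ] → ∣𝒜∣ ≤∞ ω × ω ≡ χ × χ ≤∞ ∣𝒜∣ +∞ [ 1 ])

-- The four values are variables, so that matching on the equations replaces them by computed ones.
infiniteConclusion : ∀ {k ω χ ∣Min∣ ∣𝒜∣} → ∣Min∣ ≡ [ k ] → ∣𝒜∣ ≡ ∞ →
  ω ≡ ∞ × χ ≡ ∞ → Conclusion ω χ ∣Min∣ ∣𝒜∣
infiniteConclusion ≡.refl ≡.refl (≡.refl , ≡.refl) =
  (λ _ → ≡.refl , ≡.refl) , λ _ → (∞ ≤⊤⁺) , ≡.refl , (∞ ≤⊤⁺)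

finiteConclusion : ∀ {k n ω χ ∣Min∣ ∣𝒜∣} → ∣Min∣ ≡ [ k ] → ∣𝒜∣ ≡ [ n ] →
  (2 ℕ.≤ k → ω ≡ [ k ℕ.+ n ] × χ ≡ [ k ℕ.+ n ]) →
  (k ≡ 1 → ∃[ l ] n ℕ.≤ l × l ℕ.≤ n ℕ.+ 1 × ω ≡ [ l ] × χ ≡ [ l ]) →
  Conclusion ω χ ∣Min∣ ∣𝒜∣
finiteConclusion ≡.refl ≡.refl multiple single =
  (λ { [ 2≤k ]≤ → case multiple 2≤k of λ { (≡.refl , ≡.refl) → ≡.refl , ≡.refl } }) ,
  (λ { ≡.refl → case single ≡.refl of λ
       { (l , n≤l , l≤n+1 , ≡.refl , ≡.refl) → [ n≤l ]≤ , ≡.refl , [ l≤n+1 ]≤ } })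

theorem2p1 : (em : Classical) → ∀ {c ℓ} (R : CommutativeRing c ℓ) → Noetherian R →
    let ω      = cliqueNumber em (EG R)
        χ      = chromaticNumber em (EG R)
        ∣Min∣  = card em (Min R)
        ∣𝒜∣    = card em (𝒜 R)
    in
    ([ 2 ] ≤∞ ∣Min∣ → ω ≡ χ × χ ≡ ∣Min∣ +∞ ∣𝒜∣)
    ×
    (∣Min∣ ≡ [ 1 ] → ∣𝒜∣ ≤∞ ω × ω ≡ χ × χ ≤∞ ∣𝒜∣ +∞ [ 1 ])
theorem2p1 em R noeth = case em _ {∃ (Enumeration em (𝒜 R))} of λ where
    (no infinite) → infiniteConclusion (∣Min∣≡ em R noeth)
      (the≡∞ em (Enumeration em (𝒜 R)) infinite)
      (ω-χ≡∞ em (EG R) λ n →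
        clique-𝒜 em R noeth (arbitrarilyManyDistinct em (𝒜 R) infinite n))
    (yes (n , enum)) → finiteConclusion (∣Min∣≡ em R noeth) (card≡[] em (𝒜 R) enum)
      (λ 2≤k → ω-χ≡[] em (EG R) (clique-Min+𝒜 em R noeth 2≤k (distinct em (𝒜 R) enum))
                 (colourable-Min+𝒜 em R noeth enum))
      (single enum)
  where
  single : ∀ {n} → Enumeration em (𝒜 R) n → m em R noeth ≡ 1 →
    ∃[ l ] n ℕ.≤ l × l ℕ.≤ n ℕ.+ 1 ×
      cliqueNumber em (EG R) ≡ [ l ] × chromaticNumber em (EG R) ≡ [ l ]
  single {n} enum m≡1 =
    case em _ {∃[ v ] ¬ (Ideal.Mem (proj₁ {B = IsVertex R} v) ⊆ Nil R)} of λ where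
      -- One vertex outside `𝒜` extends the clique, and the single minimal prime supplies the extra
      -- colour.
      (yes (v , v⊈Nil)) → 1 ℕ.+ n , ℕ.n≤1+n n , ℕ.≤-reflexive (ℕ.+-comm 1 n) ,
        ω-χ≡[] em (EG R)
          (clique em R noeth (λ (_ : Fin 1) → v) (λ _ → v⊈Nil)
            (λ { Fin.zero Fin.zero 0≢0 → ⊥-elim (0≢0 ≡.refl) }) (distinct em (𝒜 R) enum))
          (≡.subst (λ l → Colourable (EG R) (l ℕ.+ n)) m≡1 (colourable-Min+𝒜 em R noeth enum))
      -- Here `𝒜` exhausts the vertices and provides both the clique and the colours.
      (no allNil) → n , ℕ.≤-refl , ℕ.m≤m+n n 1 ,
        ω-χ≡[] em (EG R) (clique-𝒜 em R noeth (distinct em (𝒜 R) enum))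
          (colourable-𝒜 em R noeth enum λ v →
            decidable-stable (em _) λ v⊈Nil → allNil (v , v⊈Nil))
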